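{- Let $r,c\ge 1$ and $m\ge 0$ be integers. If $T(r,c,m)>0$, then $m\equiv rc \pmod 2$ and $m\le\max(r+1,c+1)$.
   Context: A tatami tiling of the $r\times c$ rectangular grid (with $r$ rows and $c$ columns of unit squares) is a tiling of the grid by monomers ($1\times 1$ tiles) and dimers ($1\times 2$ or $2\times 1$ tiles, horizontal or vertical) such that no point is a corner of four distinct tiles. $T(r,c,m)$ denotes the number of tatami tilings of the $r\times c$ grid that use exactly $m$ monomers. -}

module Defs where

open import Data.Fin using (Fin; toℕ)
open import Data.Fin.Properties using (all?)
open import Data.List using (List; []; _∷_; [_]; _++_; map; filter; length; upTo; cartesianProductWith)
open import Data.Nat using (ℕ; suc; _+_; _∸_; _≤_; _<_; _≟_; _≤?_; _<?_)
open import Data.Product using (_×_)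
open import Data.Sum using (_⊎_)
open import Relation.Binary.PropositionalEquality using (_≡_; refl)
open import Relation.Nullary using (Dec; yes; no)
open import Relation.Nullary.Decidable using (_×-dec_; _⊎-dec_)

data Shape : Set where
  monomer horizontal vertical : Shape

height width : Shape → ℕ
height monomer    = 1
height horizontal = 1
height vertical   = 2
width  monomer    = 1
width  horizontal = 2
width  vertical   = 1

-- `row` and `col` are the coordinates of the top-left unit square of the tile;
-- rows and columns are counted from 0.
record Tile : Set where
  constructor tile
  field
    shape : Shape
    row   : ℕ
    col   : ℕ

  bottom right : ℕ
  bottom = row + height shape
  right  = col + width shape

open Tile public

-- The unit square in row i and column j has the lattice points
-- (i , j), (i , suc j), (suc i , j) and (suc i , suc j) as its corners.
Covers : ℕ → ℕ → Tile → Set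
Covers i j t = (row t ≤ i × i < bottom t) × (col t ≤ j × j < right t)

CornerAt : ℕ → ℕ → Tile → Set
CornerAt x y t = (x ≡ row t ⊎ x ≡ bottom t) × (y ≡ col t ⊎ y ≡ right t)

IsMonomer : Tile → Set
IsMonomer t = shape t ≡ monomer

covers? : ∀ i j t → Dec (Covers i j t)
covers? i j t = (row t ≤? i ×-dec i <? bottom t) ×-dec (col t ≤? j ×-dec j <? right t)

cornerAt? : ∀ x y t → Dec (CornerAt x y t)
cornerAt? x y t = (x ≟ row t ⊎-dec x ≟ bottom t) ×-dec (y ≟ col t ⊎-dec y ≟ right t)

isMonomer? : ∀ t → Dec (IsMonomer t)
isMonomer? (tile monomer    _ _) = yes refl
isMonomer? (tile horizontal _ _) = no λ ()
isMonomer? (tile vertical   _ _) = no λ ()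

-- A tile of shape s at (i , j) lies inside the r × c grid
-- iff i + height s ≤ r and j + width s ≤ c.
placements : ℕ → ℕ → Shape → List Tile
placements r c s =
  cartesianProductWith (tile s) (upTo (suc r ∸ height s)) (upTo (suc c ∸ width s))

tiles : ℕ → ℕ → List Tile
tiles r c = placements r c monomer ++ placements r c horizontal ++ placements r c vertical

-- For a list without repetitions, such as `tiles r c`, these are its subsets,
-- each listed exactly once.
sublists : ∀ {A : Set} → List A → List (List A)
sublists []       = [ [] ]
sublists (x ∷ xs) = map (x ∷_) (sublists xs) ++ sublists xs

IsTiling : ℕ → ℕ → List Tile → Set
IsTiling r c ts =
  ∀ (i : Fin r) (j : Fin c) → length (filter (covers? (toℕ i) (toℕ j)) ts) ≡ 1

-- All corners of tiles inside the grid are among these lattice points.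
IsTatami : ℕ → ℕ → List Tile → Set
IsTatami r c ts =
  ∀ (x : Fin (suc r)) (y : Fin (suc c)) →
  length (filter (cornerAt? (toℕ x) (toℕ y)) ts) < 4

monomers : List Tile → ℕ
monomers ts = length (filter isMonomer? ts)

isTiling? : ∀ r c ts → Dec (IsTiling r c ts)
isTiling? r c ts = all? λ i → all? λ j → _ ≟ _

isTatami? : ∀ r c ts → Dec (IsTatami r c ts)
isTatami? r c ts = all? λ x → all? λ y → _ <? _

TatamiTiling : ℕ → ℕ → ℕ → List Tile → Set
TatamiTiling r c m ts = IsTiling r c ts × IsTatami r c ts × monomers ts ≡ m

tatamiTiling? : ∀ r c m ts → Dec (TatamiTiling r c m ts)
tatamiTiling? r c m ts = isTiling? r c ts ×-dec isTatami? r c ts ×-dec monomers ts ≟ m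

T : ℕ → ℕ → ℕ → ℕ
T r c m = length (filter (tatamiTiling? r c m) (sublists (tiles r c)))

{-# OPTIONS --safe #-}
module Submission where

-- A linear-programming duality certificate. Around an interior lattice point the four unit
-- squares are covered, and fewer than four tile corners meet, so the point lies on the segment
-- separating the two squares of some dimer (the midline of the dimer). Give the lattice point
-- (x , y) of the r × c grid the weight min(2x, 2(r - x), 2y, 2(c - y), k) with
-- k = min(r, c) - 1, and give unit squares the weights of the lattice points of the
-- (r - 1) × (c - 1) grid. The two ends of a midline weigh at most 2 more than the two squares
-- of its dimer. Summing over the tiling bounds the number d of dimers from below by
-- 2d ≥ (weight of all points) - (weight of all squares) ≥ rc - max(r, c) - 1, and the number
-- of monomers is rc - 2d.

open import Defs
open import Data.Bool using (true; false; if_then_else_)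
open import Data.Fin using (Fin; toℕ; fromℕ<; zero; suc)
open import Data.Fin.Properties using (toℕ<n; toℕ-fromℕ<)
open import Data.List using (List; []; _∷_; map; filter; length; upTo)
open import Data.List.Membership.Propositional using (_∈_)
open import Data.List.Membership.Propositional.Properties using (∈-++⁻; ∈-map⁻; ∈-filter⁻; ∈-cartesianProductWith⁻; ∈-upTo⁻)
open import Data.List.Relation.Unary.Any using (here; there)
open import Data.Nat using (ℕ; zero; suc; _+_; _*_; _∸_; _%_; _≤_; _<_; _⊓_; _⊔_; z≤n; s≤s; _≤?_; _<?_; _≟_)
open import Data.Nat.DivMod using ([m+kn]%n≡m%n)
open import Data.Nat.ListAction using () renaming (sum to listSum)
open import Data.Nat.Properties hiding (_≤?_; _<?_; _≟_)
open import Data.Nat.Tactic.RingSolver using (solve-∀)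
open import Data.Product using (_×_; _,_; ∃-syntax)
open import Data.Sum using (_⊎_; inj₁; inj₂)
open import Function using (_∘_)
open import Relation.Binary.Definitions using (tri<; tri≈; tri>)
open import Relation.Binary.PropositionalEquality using (_≡_; refl; sym; trans; cong; cong₂; subst; subst₂; module ≡-Reasoning)
open import Relation.Nullary using (Dec; does; contradiction)
open import Relation.Nullary.Decidable using (_×-dec_; _⊎-dec_)
open import Relation.Unary using (Decidable)
open import Algebra.Properties.Semiring.Sum +-*-semiring using (sum; sum-syntax; sum-cong-≗; ∑-distrib-+; ∑-comm)

private
  variable
    A P Q : Set

-- Sums over rectangular grids.

gridSum : ℕ → ℕ → (ℕ → ℕ → ℕ) → ℕ
gridSum m n g = ∑[ i < m ] ∑[ j < n ] g (toℕ i) (toℕ j)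

sum-mono : ∀ n {f g : Fin n → ℕ} → (∀ i → f i ≤ g i) → sum f ≤ sum g
sum-mono zero    f≤g = z≤n
sum-mono (suc n) f≤g = +-mono-≤ (f≤g zero) (sum-mono n (f≤g ∘ suc))

gridSum-mono : ∀ m n {g h : ℕ → ℕ → ℕ} → (∀ {i j} → i < m → j < n → g i j ≤ h i j) →
               gridSum m n g ≤ gridSum m n h
gridSum-mono m n g≤h = sum-mono m λ i → sum-mono n λ j → g≤h (toℕ<n i) (toℕ<n j)

gridSum-cong : ∀ m n {g h : ℕ → ℕ → ℕ} → (∀ {i j} → i < m → j < n → g i j ≡ h i j) →
               gridSum m n g ≡ gridSum m n h
gridSum-cong m n g≡h = sum-cong-≗ {m} λ i → sum-cong-≗ {n} λ j → g≡h (toℕ<n i) (toℕ<n j)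

gridSum-+ : ∀ m n (g h : ℕ → ℕ → ℕ) →
            gridSum m n (λ i j → g i j + h i j) ≡ gridSum m n g + gridSum m n h
gridSum-+ m n g h = trans
  (sum-cong-≗ {m} λ i → ∑-distrib-+ {n} (g (toℕ i) ∘ toℕ) (h (toℕ i) ∘ toℕ))
  (∑-distrib-+ {m} (λ i → ∑[ j < n ] g (toℕ i) (toℕ j)) _)

gridSum-swap : ∀ m n (g : ℕ → ℕ → ℕ) → gridSum m n g ≡ gridSum n m (λ j i → g i j)
gridSum-swap m n g = ∑-comm {m} {n} (λ i j → g (toℕ i) (toℕ j))

sum-const : ∀ n k → ∑[ i < n ] k ≡ n * k
sum-const zero    k = refl
sum-const (suc n) k = cong (k +_) (sum-const n k)

gridSum-const : ∀ m n k → gridSum m n (λ _ _ → k) ≡ m * (n * k)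
gridSum-const m n k = trans (sum-cong-≗ {m} λ _ → sum-const n k) (sum-const m (n * k))

sum-snoc : ∀ n (f : ℕ → ℕ) → ∑[ i < suc n ] f (toℕ i) ≡ ∑[ i < n ] f (toℕ i) + f n
sum-snoc zero    f = +-comm (f 0) 0
sum-snoc (suc n) f = trans (cong (f 0 +_) (sum-snoc n (f ∘ suc))) (sym (+-assoc (f 0) _ _))

-- Weights vanish on the border of the grid; this drops the outer layer in `totalWeight-inner`.
sum-inner : ∀ n (f : ℕ → ℕ) → f 0 ≡ 0 → f (suc n) ≡ 0 →
            ∑[ i < suc (suc n) ] f (toℕ i) ≡ ∑[ i < n ] f (suc (toℕ i))
sum-inner n f f0≡0 fn≡0 = begin
  f 0 + ∑[ i < suc n ] f (suc (toℕ i))         ≡⟨ cong₂ _+_ f0≡0 (sum-snoc n (f ∘ suc)) ⟩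
  ∑[ i < n ] f (suc (toℕ i)) + f (suc n)       ≡⟨ cong (∑[ i < n ] f (suc (toℕ i)) +_) fn≡0 ⟩
  ∑[ i < n ] f (suc (toℕ i)) + 0               ≡⟨ +-identityʳ _ ⟩
  ∑[ i < n ] f (suc (toℕ i))                   ∎
  where open ≡-Reasoning

sum-zero : ∀ n {f : Fin n → ℕ} → (∀ i → f i ≡ 0) → sum f ≡ 0
sum-zero n f≡0 = trans (sum-cong-≗ {n} f≡0) (trans (sum-const n 0) (*-zeroʳ n))

-- Weights of lattice points and the dimer inequality.

tent : ℕ → ℕ → ℕ
tent n x = x ⊓ (n ∸ x)

cap : ℕ → ℕ → ℕ → ℕ
cap k a b = 2 * a ⊓ (2 * b ⊓ k)

-- The graph is a pyramid of slope 2 over the `m` by `n` rectangle, zero on the border and cut off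
-- at height `k`.
weight : ℕ → ℕ → ℕ → ℕ → ℕ → ℕ
weight k m n x y = cap k (tent m x) (tent n y)

cap-comm : ∀ k a b → cap k a b ≡ cap k b a
cap-comm k a b = begin
  2 * a ⊓ (2 * b ⊓ k)  ≡⟨ ⊓-assoc (2 * a) (2 * b) k ⟨
  2 * a ⊓ (2 * b) ⊓ k    ≡⟨ cong (_⊓ k) (⊓-comm (2 * a) (2 * b)) ⟩
  2 * b ⊓ (2 * a) ⊓ k    ≡⟨ ⊓-assoc (2 * b) (2 * a) k ⟩
  2 * b ⊓ (2 * a ⊓ k)  ∎
  where open ≡-Reasoning

cap-mono : ∀ k {a a′ b b′} → a ≤ a′ → b ≤ b′ → cap k a b ≤ cap k a′ b′
cap-mono k a≤a′ b≤b′ =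
  ⊓-mono-≤ (*-monoʳ-≤ 2 a≤a′) (⊓-monoˡ-≤ k (*-monoʳ-≤ 2 b≤b′))

cap-suc : ∀ k a b → cap (2 + k) (suc a) (suc b) ≡ 2 + cap k a b
cap-suc k a b = cong₂ (λ u v → u ⊓ (v ⊓ (2 + k))) (*-suc 2 a) (*-suc 2 b)

-- Raising the cutoff from `k` to `2 + k` can only increase the left side, and then `cap-suc` is
-- exact.
cap-suc-≤ : ∀ k a b → cap k (suc a) (suc b) ≤ 2 + cap k a b
cap-suc-≤ k a b = ≤-trans
  (⊓-monoʳ-≤ (2 * suc a) (⊓-monoʳ-≤ (2 * suc b) (m≤n+m k 2)))
  (≤-reflexive (cap-suc k a b))

cap-zeroʳ : ∀ k a → cap k a 0 ≡ 0
cap-zeroʳ k a = cap-comm k a 0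

tent-self : ∀ n → tent n n ≡ 0
tent-self n = trans (cong (n ⊓_) (n∸n≡0 n)) (⊓-zeroʳ n)

tent-suc : ∀ n x → x ≤ n → tent (2 + n) (suc x) ≡ suc (tent n x)
tent-suc n x x≤n = cong (suc x ⊓_) (+-∸-assoc 1 x≤n)

-- Whichever of `y` and `n ∸ y` attains the minimum τ, the same branch of the other two minima
-- bounds both ends. The end bounded by τ itself is `y` on the rising half and `suc y` on the
-- falling half.
tent-edge : ∀ n y → y ≤ n → let τ = tent n y in
  (tent (suc n) y ≤ τ × tent (suc n) (suc y) ≤ suc τ) ⊎
  (tent (suc n) y ≤ suc τ × tent (suc n) (suc y) ≤ τ)
tent-edge n y y≤n with ≤-total y (n ∸ y)
... | inj₁ y≤d rewrite m≤n⇒m⊓n≡m y≤d = inj₁ (m⊓n≤m y _ , m⊓n≤m (suc y) _)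
... | inj₂ d≤y rewrite m≥n⇒m⊓n≡n d≤y | +-∸-assoc 1 y≤n =
  inj₂ (m⊓n≤n y _ , m⊓n≤n (suc y) _)

-- The last alternative is the peak of an even tent, where both neighbours are lower: there the
-- dimer inequality holds only because weights are cut off at k ≤ n.
tent-vertex : ∀ n x → suc x ≤ n →
  let α = tent (suc n) (suc x) ; α₁ = tent n x ; α₂ = tent n (suc x) in
  (α ≤ α₁ × α ≤ suc α₂) ⊎ (α ≤ suc α₁ × α ≤ α₂) ⊎
  (∃[ p ] α ≤ suc p × p ≤ α₁ × p ≤ α₂ × n ≡ suc (2 * p))
tent-vertex n x x<n with m≤n⇒∃[o]m+o≡n x<n
-- With `n` written as `suc x + d`, the heights are α = 1 + min(x, d), α₁ = min(x, 1 + d) and α₂ =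
-- min(1 + x, d), so comparing `x` with `d` selects the alternative.
... | d , refl rewrite sym (+-suc x d) | m+n∸m≡n x (suc d) | +-suc x d | m+n∸m≡n x d
  with <-cmp x d
... | tri< x<d _ _ = inj₂ (inj₁
  ( s≤s (⊓-monoʳ-≤ x (n≤1+n d))
  , ⊓-glb (s≤s (m⊓n≤m x d)) (≤-trans (s≤s (m⊓n≤m x d)) x<d)))
... | tri≈ _ refl _ = inj₂ (inj₂
  ( x , s≤s (m⊓n≤m x x) , ⊓-glb ≤-refl (n≤1+n x) , ⊓-glb (n≤1+n x) ≤-refl
  , cong (λ z → suc (x + z)) (sym (+-identityʳ x))))
... | tri> _ _ d<x = inj₁
  ( ⊓-glb (≤-trans (s≤s (m⊓n≤n x d)) d<x) (s≤s (m⊓n≤n x d))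
  , s≤s (⊓-monoˡ-≤ d (n≤1+n x)))

-- The ends of the midline have heights (α, β) and (α, β′), the squares (α₁, τ) and (α₂, τ). On a
-- slope, the end bounded by τ is charged to the square whose first height is at least α, at no
-- cost. The other end is charged to the other square: both heights rise by at most 1, hence the
-- weight by at most 2. At the peak α may exceed both α₁ and α₂, and the cutoff `k` comes in.
cap-dimer : ∀ k {α α₁ α₂ β β′ τ} →
  (α ≤ α₁ × α ≤ suc α₂) ⊎ (α ≤ suc α₁ × α ≤ α₂) ⊎
    (∃[ p ] α ≤ suc p × p ≤ α₁ × p ≤ α₂ × k ≤ suc (2 * p)) →
  (β ≤ τ × β′ ≤ suc τ) ⊎ (β ≤ suc τ × β′ ≤ τ) →
  cap k α β + cap k α β′ ≤ 2 + (cap k α₁ τ + cap k α₂ τ)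
cap-dimer k {α} {α₁} {α₂} {β} {β′} {τ} slopeα slopeβ = case-α slopeα slopeβ
  where
  open ≤-Reasoning
  A₁ = cap k α₁ τ
  A₂ = cap k α₂ τ
  B = cap k α β
  B′ = cap k α β′
  low : ∀ a b → α ≤ a → b ≤ τ → cap k α b ≤ cap k a τ
  low a b = cap-mono k {α} {a} {b} {τ}
  high : ∀ a b → α ≤ suc a → b ≤ suc τ → cap k α b ≤ 2 + cap k a τ
  high a b α≤ b≤ = ≤-trans (cap-mono k {α} {suc a} {b} {suc τ} α≤ b≤) (cap-suc-≤ k a τ)
  2+ʳ : ∀ x y → x + (2 + y) ≡ 2 + (x + y)
  2+ʳ = solve-∀
  +-bound : ∀ {u v} x y → u ≤ x → v ≤ 2 + y → u + v ≤ 2 + (x + y)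
  +-bound x y u≤ v≤ = ≤-trans (+-mono-≤ u≤ v≤) (≤-reflexive (2+ʳ x y))
  swapˡ : ∀ u v {x} → u + v ≤ x → v + u ≤ x
  swapˡ u v {x} = subst (_≤ x) (+-comm u v)
  swapʳ : ∀ {u} x y → u ≤ 2 + (x + y) → u ≤ 2 + (y + x)
  swapʳ {u} x y = subst (λ z → u ≤ 2 + z) (+-comm x y)
  case-α : _ → _ → B + B′ ≤ 2 + (A₁ + A₂)
  case-α (inj₁ (a , a′)) (inj₁ (b , b′)) = +-bound A₁ A₂ (low α₁ β a b) (high α₂ β′ a′ b′)
  case-α (inj₁ (a , a′)) (inj₂ (b′ , b)) =
    swapˡ B′ B (+-bound A₁ A₂ (low α₁ β′ a b) (high α₂ β a′ b′))
  case-α (inj₂ (inj₁ (a′ , a))) (inj₁ (b , b′)) =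
    swapʳ A₂ A₁ (+-bound A₂ A₁ (low α₂ β a b) (high α₁ β′ a′ b′))
  case-α (inj₂ (inj₁ (a′ , a))) (inj₂ (b′ , b)) =
    swapʳ A₂ A₁ (swapˡ B′ B (+-bound A₂ A₁ (low α₂ β′ a b) (high α₁ β a′ b′)))
  -- At the peak both squares are first replaced by one of heights `p` and τ, which can only lower
  -- the right side.
  case-α (inj₂ (inj₂ (p , α≤ , p≤₁ , p≤₂ , k≤))) slope =
    ≤-trans (level slope) (s≤s (s≤s (+-mono-≤
      (cap-mono k {p} {α₁} {τ} {τ} p≤₁ ≤-refl) (cap-mono k {p} {α₂} {τ} {τ} p≤₂ ≤-refl))))
    where
    -- When τ ≤ p, the entry 2p of the minimum is not binding, so the larger α gains nothing for an
    -- end with `b ≤ τ`.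
    low-p : ∀ b → τ ≤ p → b ≤ τ → cap k α b ≤ cap k p τ
    low-p b τ≤p b≤τ = begin
      2 * α ⊓ (2 * b ⊓ k)  ≤⟨ m⊓n≤n (2 * α) _ ⟩
      2 * b ⊓ k            ≤⟨ ⊓-monoˡ-≤ k (*-monoʳ-≤ 2 b≤τ) ⟩
      2 * τ ⊓ k            ≤⟨ ⊓-glb (≤-trans (m⊓n≤m (2 * τ) k) (*-monoʳ-≤ 2 τ≤p)) ≤-refl ⟩
      2 * p ⊓ (2 * τ ⊓ k)  ∎
    -- When p ≤ τ, `k` exceeds none of 2p, 2τ and `k` by more than 1. Each end then gains at most 1,
    -- which makes 2 in all.
    half : ∀ b → p ≤ τ → cap k α b ≤ suc (cap k p τ)
    half b p≤τ = begin
      2 * α ⊓ (2 * b ⊓ k)  ≤⟨ ≤-trans (m⊓n≤n (2 * α) _) (m⊓n≤n (2 * b) k) ⟩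
      k                    ≤⟨ ⊓-glb k≤ (⊓-glb (≤-trans k≤ (s≤s (*-monoʳ-≤ 2 p≤τ))) (n≤1+n k)) ⟩
      suc (cap k p τ)      ∎
    C = cap k p τ
    level : _ → B + B′ ≤ 2 + (C + C)
    level slope with ≤-total τ p | slope
    ... | inj₂ p≤τ | _ = subst (B + B′ ≤_)
      (cong suc (+-suc C C)) (+-mono-≤ (half β p≤τ) (half β′ p≤τ))
    ... | inj₁ τ≤p | inj₁ (b , b′) = +-bound C C (low-p β τ≤p b) (high p β′ α≤ b′)
    ... | inj₁ τ≤p | inj₂ (b′ , b) =
      swapˡ B′ B (+-bound C C (low-p β′ τ≤p b) (high p β α≤ b′))

-- The midline of the vertical dimer at `(i , j)` runs along lattice row `suc i`. At the peak `m` is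
-- `suc (2 * p)`, so `k ≤ m` is the cutoff condition that `cap-dimer` asks for.
weight-vertical : ∀ k m n {i j} → k ≤ m → suc i ≤ m → j ≤ n →
  weight k (suc m) (suc n) (suc i) j + weight k (suc m) (suc n) (suc i) (suc j) ≤
  2 + (weight k m n i j + weight k m n (suc i) j)
weight-vertical k m n {i} {j} k≤m i<m j≤n =
  cap-dimer k (relax (tent-vertex m i i<m)) (tent-edge n j j≤n)
  where
  relax : ∀ {A B : Set} {C D E : ℕ → Set} →
    A ⊎ B ⊎ (∃[ p ] C p × D p × E p × m ≡ suc (2 * p)) →
    A ⊎ B ⊎ (∃[ p ] C p × D p × E p × k ≤ suc (2 * p))
  relax (inj₁ a) = inj₁ a
  relax (inj₂ (inj₁ b)) = inj₂ (inj₁ b)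
  relax (inj₂ (inj₂ (p , c , d , e , refl))) = inj₂ (inj₂ (p , c , d , e , k≤m))

weight-comm : ∀ k m n x y → weight k m n x y ≡ weight k n m y x
weight-comm k m n x y = cap-comm k (tent m x) (tent n y)

weight-horizontal : ∀ k m n {i j} → k ≤ n → i ≤ m → suc j ≤ n →
  weight k (suc m) (suc n) i (suc j) + weight k (suc m) (suc n) (suc i) (suc j) ≤
  2 + (weight k m n i j + weight k m n i (suc j))
weight-horizontal k m n {i} {j} k≤n i≤m j<n
  rewrite weight-comm k (suc m) (suc n) i (suc j) | weight-comm k (suc m) (suc n) (suc i) (suc j)
        | weight-comm k m n i j | weight-comm k m n i (suc j)
  = weight-vertical k n m k≤n j<n i≤m

weight-top : ∀ k m n y → weight k m n 0 y ≡ 0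
weight-top k m n y = refl

weight-bottom : ∀ k m n y → weight k m n m y ≡ 0
weight-bottom k m n y = cong (λ a → cap k a (tent n y)) (tent-self m)

weight-left : ∀ k m n x → weight k m n x 0 ≡ 0
weight-left k m n x = cap-zeroʳ k (tent m x)

weight-right : ∀ k m n x → weight k m n x n ≡ 0
weight-right k m n x = trans (cong (cap k (tent m x)) (tent-self n)) (cap-zeroʳ k (tent m x))

-- Total weights of grids.

totalWeight : ℕ → ℕ → ℕ → ℕ
totalWeight k m n = gridSum (suc m) (suc n) (weight k m n)

totalWeight-comm : ∀ k m n → totalWeight k m n ≡ totalWeight k n m
totalWeight-comm k m n = trans (gridSum-swap (suc m) (suc n) (weight k m n))
  (gridSum-cong (suc n) (suc m) λ {y} {x} _ _ → weight-comm k m n x y)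

totalWeight-inner : ∀ k m n → totalWeight k (2 + m) (2 + n) ≡
  gridSum (suc m) (suc n) (λ x y → weight k (2 + m) (2 + n) (suc x) (suc y))
totalWeight-inner k m n = trans
  (sum-inner (suc m) (λ x → ∑[ y < 3 + n ] w x (toℕ y))
    (sum-zero (3 + n) λ y → weight-top k (2 + m) (2 + n) (toℕ y))
    (sum-zero (3 + n) λ y → weight-bottom k (2 + m) (2 + n) (toℕ y)))
  (sum-cong-≗ {suc m} λ x → sum-inner (suc n) (w (suc (toℕ x)))
    (weight-left k (2 + m) (2 + n) (suc (toℕ x)))
    (weight-right k (2 + m) (2 + n) (suc (toℕ x))))
  where
  w = weight k (2 + m) (2 + n)

-- The border weighs 0. Inside it lies a copy of the points of the `m` by `n` grid, with both tents
-- raised by 1 and the cutoff by 2, so each weight grows by exactly 2.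
totalWeight-step : ∀ k m n → totalWeight (2 + k) (2 + m) (2 + n) ≡
  2 * (suc m * suc n) + totalWeight k m n
totalWeight-step k m n = begin
  totalWeight (2 + k) (2 + m) (2 + n)
    ≡⟨ totalWeight-inner (2 + k) m n ⟩
  gridSum (suc m) (suc n) (λ x y → weight (2 + k) (2 + m) (2 + n) (suc x) (suc y))
    ≡⟨ gridSum-cong (suc m) (suc n) (λ { {x} {y} (s≤s x≤m) (s≤s y≤n) → trans
         (cong₂ (cap (2 + k)) (tent-suc m x x≤m) (tent-suc n y y≤n))
         (cap-suc k (tent m x) (tent n y)) }) ⟩
  gridSum (suc m) (suc n) (λ x y → 2 + weight k m n x y)
    ≡⟨ gridSum-+ (suc m) (suc n) (λ _ _ → 2) (weight k m n) ⟩
  gridSum (suc m) (suc n) (λ _ _ → 2) + totalWeight k m n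
    ≡⟨ cong (_+ totalWeight k m n) (gridSum-const (suc m) (suc n) 2) ⟩
  suc m * (suc n * 2) + totalWeight k m n
    ≡⟨ cong (_+ totalWeight k m n) (arith (suc m) (suc n)) ⟩
  2 * (suc m * suc n) + totalWeight k m n ∎
  where
  open ≡-Reasoning
  arith : ∀ a b → a * (b * 2) ≡ 2 * (a * b)
  arith = solve-∀

-- Induction in steps of two, with base cases 0 and 1. Peeling a layer off both totals by
-- `totalWeight-step` leaves an excess of 2 on the left, which pays for the growth of the bound from
-- `2 + n` to `4 + n`.
totalWeight-gap : ∀ m n → m ≤ n →
  suc m * suc n + totalWeight m m n ≤ totalWeight m (suc m) (suc n) + (2 + n)
totalWeight-gap 0 n _ = begin
  suc n + 0 + totalWeight 0 0 n             ≡⟨ cong (suc n + 0 +_) zero₀ ⟩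
  suc n + 0 + 0                             ≡⟨ cong (_+ 0) (+-identityʳ (suc n)) ⟩
  suc n + 0                                 ≡⟨ +-identityʳ (suc n) ⟩
  suc n                                     ≤⟨ n≤1+n (suc n) ⟩
  2 + n                                     ≤⟨ m≤n+m (2 + n) _ ⟩
  totalWeight 0 1 (suc n) + (2 + n)         ∎
  where
  open ≤-Reasoning
  zero₀ : totalWeight 0 0 n ≡ 0
  zero₀ = cong (_+ 0) (sum-zero (suc n) λ y → weight-top 0 0 n (toℕ y))
-- With cutoff 1, each of the `suc n` interior points of the 2 by `2 + n` grid weighs at least 1,
-- whereas the 1 by `suc n` grid has only border points.
totalWeight-gap 1 (suc n) _ = begin
  2 * suc (suc n) + totalWeight 1 1 (suc n)   ≡⟨ cong (2 * suc (suc n) +_) zero₁ ⟩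
  2 * suc (suc n) + 0                         ≡⟨ arith n ⟩
  suc n + (3 + n)                             ≤⟨ +-monoˡ-≤ (3 + n) inner ⟩
  totalWeight 1 2 (2 + n) + (3 + n)           ∎
  where
  open ≤-Reasoning
  arith : ∀ n → 2 * suc (suc n) + 0 ≡ suc n + (3 + n)
  arith = solve-∀
  zero₁ : totalWeight 1 1 (suc n) ≡ 0
  zero₁ = cong₂ (λ a b → a + (b + 0))
    (sum-zero (2 + n) λ y → weight-top 1 1 (suc n) (toℕ y))
    (sum-zero (2 + n) λ y → weight-bottom 1 1 (suc n) (toℕ y))
  inner : suc n ≤ totalWeight 1 2 (2 + n)
  inner = begin
    suc n             ≡⟨ trans (sym (*-identityʳ (suc n))) (sym (+-identityʳ _)) ⟩
    1 * (suc n * 1)   ≡⟨ gridSum-const 1 (suc n) 1 ⟨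
    gridSum 1 (suc n) (λ _ _ → 1)
      ≤⟨ gridSum-mono 1 (suc n)
           {h = λ x y → weight 1 2 (2 + n) (suc x) (suc y)} one≤ ⟩
    gridSum 1 (suc n) (λ x y → weight 1 2 (2 + n) (suc x) (suc y))
      ≡⟨ totalWeight-inner 1 0 n ⟨
    totalWeight 1 2 (2 + n) ∎
    where
    one≤ : ∀ {x y} → x < 1 → y < suc n → 1 ≤ weight 1 2 (2 + n) (suc x) (suc y)
    one≤ {y = y} (s≤s z≤n) (s≤s y≤n) rewrite tent-suc n y y≤n =
      ⊓-glb (s≤s z≤n) (⊓-glb {x = 1} {y = 2 * suc (tent n y)} (s≤s z≤n) ≤-refl)
totalWeight-gap (suc (suc m)) (suc (suc n)) (s≤s (s≤s m≤n)) = begin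
  (3 + m) * (3 + n) + totalWeight (2 + m) (2 + m) (2 + n)
    ≡⟨ cong ((3 + m) * (3 + n) +_) (totalWeight-step m m n) ⟩
  (3 + m) * (3 + n) + (2 * (suc m * suc n) + totalWeight m m n)
    ≡⟨ arith₁ m n (totalWeight m m n) ⟩
  2 * ((2 + m) * (2 + n)) + 2 + (suc m * suc n + totalWeight m m n)
    ≤⟨ +-monoʳ-≤ _ (totalWeight-gap m n m≤n) ⟩
  2 * ((2 + m) * (2 + n)) + 2 + (totalWeight m (suc m) (suc n) + (2 + n))
    ≡⟨ arith₂ (2 * ((2 + m) * (2 + n))) _ n ⟩
  2 * ((2 + m) * (2 + n)) + totalWeight m (suc m) (suc n) + (4 + n)
    ≡⟨ cong (_+ (4 + n)) (totalWeight-step m (suc m) (suc n)) ⟨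
  totalWeight (2 + m) (3 + m) (3 + n) + (4 + n) ∎
  where
  open ≤-Reasoning
  arith₁ : ∀ m n w → (3 + m) * (3 + n) + (2 * (suc m * suc n) + w) ≡
                     2 * ((2 + m) * (2 + n)) + 2 + (suc m * suc n + w)
  arith₁ = solve-∀
  arith₂ : ∀ u w n → u + 2 + (w + (2 + n)) ≡ u + w + (4 + n)
  arith₂ = solve-∀

-- Indicators and sums over lists.

χ : Dec P → ℕ
χ d = if does d then 1 else 0

χ-× : (p : Dec P) (q : Dec Q) → χ (p ×-dec q) ≡ χ p * χ q
χ-× p q with does p
... | true  = sym (+-identityʳ (χ q))
... | false = refl

total : (A → ℕ) → List A → ℕ
total f ts = listSum (map f ts)

-- Turns the counts in `IsTiling` and `IsTatami` into sums, which can be added and interchanged with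
-- grid sums.
length-filter : {P : A → Set} (P? : Decidable P) (ts : List A) →
                length (filter P? ts) ≡ total (χ ∘ P?) ts
length-filter P? []       = refl
length-filter P? (t ∷ ts) with does (P? t)
... | true  = cong suc (length-filter P? ts)
... | false = length-filter P? ts

total-mono : (f g : A → ℕ) (ts : List A) → (∀ {t} → t ∈ ts → f t ≤ g t) → total f ts ≤ total g ts
total-mono f g []       f≤g = z≤n
total-mono f g (t ∷ ts) f≤g = +-mono-≤ (f≤g (here refl)) (total-mono f g ts (f≤g ∘ there))

total-cong : (f g : A → ℕ) (ts : List A) → (∀ {t} → t ∈ ts → f t ≡ g t) → total f ts ≡ total g ts
total-cong f g []       f≡g = refl
total-cong f g (t ∷ ts) f≡g = cong₂ _+_ (f≡g (here refl)) (total-cong f g ts (f≡g ∘ there))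

total-+ : (f g : A → ℕ) (ts : List A) → total (λ t → f t + g t) ts ≡ total f ts + total g ts
total-+ f g []       = refl
total-+ f g (t ∷ ts) = trans (cong (f t + g t +_) (total-+ f g ts))
  (arith (f t) (g t) (total f ts) (total g ts))
  where
  arith : ∀ a b c d → a + b + (c + d) ≡ a + c + (b + d)
  arith = solve-∀

total-* : (k : ℕ) (f : A → ℕ) (ts : List A) → total (λ t → k * f t) ts ≡ k * total f ts
total-* k f []       = sym (*-zeroʳ k)
total-* k f (t ∷ ts) = trans (cong (k * f t +_) (total-* k f ts))
  (sym (*-distribˡ-+ k (f t) (total f ts)))

gridSum-zero : ∀ m n → gridSum m n (λ _ _ → 0) ≡ 0
gridSum-zero m n = trans (gridSum-const m n 0) (trans (cong (m *_) (*-zeroʳ n)) (*-zeroʳ m))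

-- Double counting: the sum over the grid is interchanged with the sum over the tiles.
gridSum-total : ∀ m n (g : ℕ → ℕ → ℕ) (φ : A → ℕ → ℕ → ℕ) ts →
  gridSum m n (λ i j → g i j * total (λ t → φ t i j) ts) ≡
  total (λ t → gridSum m n (λ i j → g i j * φ t i j)) ts
gridSum-total m n g φ [] =
  trans (gridSum-cong m n λ {i} {j} _ _ → *-zeroʳ (g i j)) (gridSum-zero m n)
gridSum-total m n g φ (t ∷ ts) = begin
  gridSum m n (λ i j → g i j * (φ t i j + total (λ t → φ t i j) ts))
    ≡⟨ gridSum-cong m n (λ {i} {j} _ _ → *-distribˡ-+ (g i j) (φ t i j) (total (λ t → φ t i j) ts)) ⟩
  gridSum m n (λ i j → g i j * φ t i j + g i j * total (λ t → φ t i j) ts)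
    ≡⟨ gridSum-+ m n (λ i j → g i j * φ t i j) (λ i j → g i j * total (λ t → φ t i j) ts) ⟩
  gridSum m n (λ i j → g i j * φ t i j) + gridSum m n (λ i j → g i j * total (λ t → φ t i j) ts)
    ≡⟨ cong (gridSum m n (λ i j → g i j * φ t i j) +_) (gridSum-total m n g φ ts) ⟩
  total (λ t → gridSum m n (λ i j → g i j * φ t i j)) (t ∷ ts) ∎
  where open ≡-Reasoning

-- Grid sums against Kronecker deltas.

δ : ℕ → ℕ → ℕ
δ a x = χ (x ≟ a)

sum-δ : ∀ n (f : ℕ → ℕ) {a} → a < n → ∑[ i < n ] (f (toℕ i) * δ a (toℕ i)) ≡ f a
sum-δ (suc n) f {zero} _ = begin
  f 0 * 1 + ∑[ i < n ] (f (suc (toℕ i)) * 0)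
    ≡⟨ cong₂ _+_ (*-identityʳ (f 0)) (sum-zero n λ i → *-zeroʳ (f (suc (toℕ i)))) ⟩
  f 0 + 0
    ≡⟨ +-identityʳ (f 0) ⟩
  f 0 ∎
  where open ≡-Reasoning
sum-δ (suc n) f {suc a} (s≤s a<n) =
  trans (cong (_+ ∑[ i < n ] (f (suc (toℕ i)) * δ a (toℕ i))) (*-zeroʳ (f 0))) (sum-δ n (f ∘ suc) a<n)

gridSum-δ : ∀ m n (g : ℕ → ℕ → ℕ) {a b} → a < m → b < n →
            gridSum m n (λ i j → g i j * (δ a i * δ b j)) ≡ g a b
gridSum-δ m n g {a} {b} a<m b<n = trans
  (sum-cong-≗ {m} λ i → inner (toℕ i))
  (sum-δ m (λ i → g i b) a<m)
  where
  arith : ∀ x y z → x * (y * z) ≡ x * y * z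
  arith = solve-∀
  inner : ∀ i → ∑[ j < n ] (g i (toℕ j) * (δ a i * δ b (toℕ j))) ≡ g i b * δ a i
  inner i = trans
    (sum-cong-≗ {n} λ j → arith (g i (toℕ j)) (δ a i) (δ b (toℕ j)))
    (sum-δ n (λ j → g i j * δ a i) b<n)

gridSum-horizontal : ∀ m n (g : ℕ → ℕ → ℕ) {a b} → a < m → suc b < n →
  gridSum m n (λ i j → g i j * (δ a i * (δ b j + δ (suc b) j))) ≡ g a b + g a (suc b)
gridSum-horizontal m n g {a} {b} a<m b<n = begin
  gridSum m n (λ i j → g i j * (δ a i * (δ b j + δ (suc b) j)))
    ≡⟨ gridSum-cong m n (λ {i} {j} _ _ → arith (g i j) (δ a i) (δ b j) (δ (suc b) j)) ⟩
  gridSum m n (λ i j → g i j * (δ a i * δ b j) + g i j * (δ a i * δ (suc b) j))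
    ≡⟨ gridSum-+ m n (λ i j → g i j * (δ a i * δ b j)) (λ i j → g i j * (δ a i * δ (suc b) j)) ⟩
  gridSum m n (λ i j → g i j * (δ a i * δ b j)) + gridSum m n (λ i j → g i j * (δ a i * δ (suc b) j))
    ≡⟨ cong₂ _+_ (gridSum-δ m n g a<m (<⇒≤ b<n)) (gridSum-δ m n g a<m b<n) ⟩
  g a b + g a (suc b) ∎
  where
  open ≡-Reasoning
  arith : ∀ g x y z → g * (x * (y + z)) ≡ g * (x * y) + g * (x * z)
  arith = solve-∀

gridSum-vertical : ∀ m n (g : ℕ → ℕ → ℕ) {a b} → suc a < m → b < n →
  gridSum m n (λ i j → g i j * ((δ a i + δ (suc a) i) * δ b j)) ≡ g a b + g (suc a) b
gridSum-vertical m n g {a} {b} a<m b<n = trans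
  (gridSum-swap m n (λ i j → g i j * ((δ a i + δ (suc a) i) * δ b j)))
  (trans
    (gridSum-cong n m λ {j} {i} _ _ → cong (g i j *_) (*-comm (δ a i + δ (suc a) i) (δ b j)))
    (gridSum-horizontal n m (λ j i → g i j) b<n a<m))

-- Incidence of tiles with squares and lattice points.

cells : Tile → ℕ → ℕ → ℕ
cells (tile monomer    a b) i j = δ a i * δ b j
cells (tile horizontal a b) i j = δ a i * (δ b j + δ (suc b) j)
cells (tile vertical   a b) i j = (δ a i + δ (suc a) i) * δ b j

-- The lattice points at the ends of the segment separating the two squares of a dimer.
midline : Tile → ℕ → ℕ → ℕ
midline (tile monomer    a b) x y = 0
midline (tile horizontal a b) x y = (δ a x + δ (suc a) x) * δ (suc b) y
midline (tile vertical   a b) x y = δ (suc a) x * (δ b y + δ (suc b) y)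

-- Products of sums of deltas, as in `cells` and `midline`, make the count around a lattice point a
-- polynomial identity within reach of the ring solver.
corners : Tile → ℕ → ℕ → ℕ
corners (tile monomer    a b) x y = (δ a x + δ (1 + a) x) * (δ b y + δ (1 + b) y)
corners (tile horizontal a b) x y = (δ a x + δ (1 + a) x) * (δ b y + δ (2 + b) y)
corners (tile vertical   a b) x y = (δ a x + δ (2 + a) x) * (δ b y + δ (1 + b) y)

span : ℕ → ℕ → ℕ → ℕ
span h a i = χ (a ≤? i ×-dec i <? a + h)

-- The Boolean test behind `_≤?_` matches on its left argument, so the split on `a` lets both sides
-- compute.
span-suc : ∀ h a i → span h (suc a) (suc i) ≡ span h a i
span-suc h zero    i = refl
span-suc h (suc a) i = refl

span-1 : ∀ a i → span 1 a i ≡ δ a i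
span-1 zero    zero          = refl
span-1 zero    (suc i)       = refl
span-1 (suc a) zero          = refl
span-1 (suc a) (suc i)       = trans (span-suc 1 a i) (span-1 a i)

span-2 : ∀ a i → span 2 a i ≡ δ a i + δ (suc a) i
span-2 zero    zero          = refl
span-2 zero    (suc zero)    = refl
span-2 zero    (suc (suc i)) = refl
span-2 (suc a) zero          = refl
span-2 (suc a) (suc i)       = trans (span-suc 2 a i) (span-2 a i)

χ-covers : ∀ t i j → χ (covers? i j t) ≡ cells t i j
χ-covers (tile s a b) i j = trans
  (χ-× (a ≤? i ×-dec i <? a + height s) (b ≤? j ×-dec j <? b + width s)) (by-shape s)
  where
  by-shape : ∀ s → span (height s) a i * span (width s) b j ≡ cells (tile s a b) i j
  by-shape monomer    = cong₂ _*_ (span-1 a i) (span-1 b j)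
  by-shape horizontal = cong₂ _*_ (span-1 a i) (span-2 b j)
  by-shape vertical   = cong₂ _*_ (span-2 a i) (span-1 b j)

ends : ℕ → ℕ → ℕ → ℕ
ends h a x = χ (x ≟ a ⊎-dec x ≟ a + h)

ends-1 : ∀ a x → ends 1 a x ≡ δ a x + δ (1 + a) x
ends-1 zero    zero    = refl
ends-1 zero    (suc x) = refl
ends-1 (suc a) zero    = refl
ends-1 (suc a) (suc x) = ends-1 a x

ends-2 : ∀ a x → ends 2 a x ≡ δ a x + δ (2 + a) x
ends-2 zero    zero    = refl
ends-2 zero    (suc x) = refl
ends-2 (suc a) zero    = refl
ends-2 (suc a) (suc x) = ends-2 a x

χ-corner : ∀ t x y → χ (cornerAt? x y t) ≡ corners t x y
χ-corner (tile s a b) x y = trans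
  (χ-× (x ≟ a ⊎-dec x ≟ a + height s) (y ≟ b ⊎-dec y ≟ b + width s)) (by-shape s)
  where
  by-shape : ∀ s → ends (height s) a x * ends (width s) b y ≡ corners (tile s a b) x y
  by-shape monomer    = cong₂ _*_ (ends-1 a x) (ends-1 b y)
  by-shape horizontal = cong₂ _*_ (ends-1 a x) (ends-2 b y)
  by-shape vertical   = cong₂ _*_ (ends-2 a x) (ends-1 b y)

-- Of the four squares around a lattice point, a tile covers one if the point is one of its
-- corners and two if the point is on its midline.
cells-around : ∀ t x y →
  (cells t x y + cells t x (suc y)) + (cells t (suc x) y + cells t (suc x) (suc y)) ≡
  corners t (suc x) (suc y) + 2 * midline t (suc x) (suc y)
cells-around (tile monomer a b) x y =
  -- Since `δ (suc a) (suc x)` computes to `δ a x`, these deltas express both sides.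
  arith (δ a x) (δ a (suc x)) (δ b y) (δ b (suc y))
  where
  arith : ∀ p q u v → (p * u + p * v) + (q * u + q * v) ≡ (q + p) * (v + u) + 2 * 0
  arith = solve-∀
cells-around (tile horizontal a b) x y =
  arith (δ a x) (δ a (suc x)) (δ b y) (δ b (suc y)) (δ (suc b) y)
  where
  arith : ∀ p q u v w → (p * (u + w) + p * (v + u)) + (q * (u + w) + q * (v + u)) ≡
                        (q + p) * (v + w) + 2 * ((q + p) * u)
  arith = solve-∀
cells-around (tile vertical a b) x y =
  arith (δ b y) (δ b (suc y)) (δ a x) (δ a (suc x)) (δ (suc a) x)
  where
  arith : ∀ p q u v w → ((u + w) * p + (u + w) * q) + ((v + u) * p + (v + u) * q) ≡
                        (v + w) * (q + p) + 2 * (u * (q + p))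
  arith = solve-∀

-- Tiles inside the grid.

InGrid : ℕ → ℕ → Tile → Set
InGrid r c t = bottom t ≤ r × right t ≤ c

sublist-⊆ : ∀ (xs : List A) {ys} → ys ∈ sublists xs → ∀ {y} → y ∈ ys → y ∈ xs
sublist-⊆ []       (here refl) ()
sublist-⊆ (x ∷ xs) ys∈ y∈ with ∈-++⁻ (map (x ∷_) (sublists xs)) ys∈
... | inj₂ ys∈′ = there (sublist-⊆ xs ys∈′ y∈)
... | inj₁ ys∈′ with ∈-map⁻ (x ∷_) ys∈′ | y∈
...   | zs , zs∈ , refl | here y≡x = here y≡x
...   | zs , zs∈ , refl | there y∈zs = there (sublist-⊆ xs zs∈ y∈zs)

placement-inGrid : ∀ r c s {t} → t ∈ placements r c s → InGrid r c t
placement-inGrid r c s t∈ with ∈-cartesianProductWith⁻ (tile s) (upTo (suc r ∸ height s)) (upTo (suc c ∸ width s)) t∈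
... | a , b , a∈ , b∈ , refl = fits r a (height s) (∈-upTo⁻ a∈) , fits c b (width s) (∈-upTo⁻ b∈)
  where
  -- By contraposition, which copes with truncated subtraction: `suc n ≤ h + a` would give
  -- `suc n ∸ h ≤ a`.
  fits : ∀ n a h → a < suc n ∸ h → a + h ≤ n
  fits n a h a< = ≤-pred (≰⇒> λ n< →
    <⇒≱ a< (m≤n+o⇒m∸n≤o (suc n) h (subst (suc n ≤_) (+-comm a h) n<)))

tiles-inGrid : ∀ r c {t} → t ∈ tiles r c → InGrid r c t
tiles-inGrid r c t∈ with ∈-++⁻ (placements r c monomer) t∈
... | inj₁ t∈′ = placement-inGrid r c monomer t∈′
... | inj₂ t∈′ with ∈-++⁻ (placements r c horizontal) t∈′
...   | inj₁ t∈″ = placement-inGrid r c horizontal t∈″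
...   | inj₂ t∈″ = placement-inGrid r c vertical t∈″

-- Contribution of a single tile.

dimer : Tile → ℕ
dimer (tile monomer    _ _) = 0
dimer (tile horizontal _ _) = 1
dimer (tile vertical   _ _) = 1

-- The factor 1 presents the area as a weighted sum of the form that `gridSum-tiles` evaluates.
area : ∀ r c t → InGrid r c t →
  gridSum r c (λ i j → 1 * cells t i j) ≡ χ (isMonomer? t) + 2 * dimer t
area r c (tile monomer a b) (a≤ , b≤) rewrite +-comm a 1 | +-comm b 1 =
  gridSum-δ r c (λ _ _ → 1) a≤ b≤
area r c (tile horizontal a b) (a≤ , b≤) rewrite +-comm a 1 | +-comm b 2 =
  gridSum-horizontal r c (λ _ _ → 1) a≤ b≤
area r c (tile vertical a b) (a≤ , b≤) rewrite +-comm a 2 | +-comm b 1 =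
  gridSum-vertical r c (λ _ _ → 1) a≤ b≤

-- Feasibility of the dual weights, tile by tile. The deltas pick out the two ends of the midline
-- and the two squares, which leaves the dimer inequality; a monomer has no midline. Lattice points
-- have one more row and column than squares.
midline-weight : ∀ k m n t → k ≤ m → k ≤ n → InGrid (suc m) (suc n) t →
  gridSum (2 + m) (2 + n) (λ x y → weight k (suc m) (suc n) x y * midline t x y) ≤
  2 * dimer t + gridSum (suc m) (suc n) (λ i j → weight k m n i j * cells t i j)
midline-weight k m n (tile monomer a b) _ _ _ = begin
  gridSum (2 + m) (2 + n) (λ x y → weight k (suc m) (suc n) x y * 0)
    ≡⟨ gridSum-cong (2 + m) (2 + n) (λ {x} {y} _ _ → *-zeroʳ (weight k (suc m) (suc n) x y)) ⟩
  gridSum (2 + m) (2 + n) (λ _ _ → 0)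
    ≡⟨ gridSum-zero (2 + m) (2 + n) ⟩
  0
    ≤⟨ z≤n ⟩
  gridSum (suc m) (suc n) (λ i j → weight k m n i j * (δ a i * δ b j)) ∎
  where open ≤-Reasoning
midline-weight k m n (tile horizontal a b) _ k≤n (a≤ , b≤)
  rewrite +-comm a 1 | +-comm b 2 = begin
  gridSum (2 + m) (2 + n) (λ x y → W x y * ((δ a x + δ (suc a) x) * δ (suc b) y))
    -- The midline of a horizontal dimer is a vertical segment, so the directions trade places.
    ≡⟨ gridSum-vertical (2 + m) (2 + n) W (s≤s a≤) (<⇒≤ (s≤s b≤)) ⟩
  W a (suc b) + W (suc a) (suc b)
    ≤⟨ weight-horizontal k m n k≤n (≤-pred a≤) (≤-pred b≤) ⟩
  2 + (w a b + w a (suc b))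
    ≡⟨ cong (2 +_) (gridSum-horizontal (suc m) (suc n) w a≤ b≤) ⟨
  2 + gridSum (suc m) (suc n) (λ i j → w i j * (δ a i * (δ b j + δ (suc b) j))) ∎
  where
  open ≤-Reasoning
  W = weight k (suc m) (suc n)
  w = weight k m n
midline-weight k m n (tile vertical a b) k≤m _ (a≤ , b≤)
  rewrite +-comm a 2 | +-comm b 1 = begin
  gridSum (2 + m) (2 + n) (λ x y → W x y * (δ (suc a) x * (δ b y + δ (suc b) y)))
    ≡⟨ gridSum-horizontal (2 + m) (2 + n) W (<⇒≤ (s≤s a≤)) (s≤s b≤) ⟩
  W (suc a) b + W (suc a) (suc b)
    ≤⟨ weight-vertical k m n k≤m (≤-pred a≤) (≤-pred b≤) ⟩
  2 + (w a b + w (suc a) b)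
    ≡⟨ cong (2 +_) (gridSum-vertical (suc m) (suc n) w a≤ b≤) ⟨
  2 + gridSum (suc m) (suc n) (λ i j → w i j * ((δ a i + δ (suc a) i) * δ b j)) ∎
  where
  open ≤-Reasoning
  W = weight k (suc m) (suc n)
  w = weight k m n

-- Counting over a tatami tiling.

module Tatami {m n : ℕ} {ts : List Tile}
  (inGrid : ∀ {t} → t ∈ ts → InGrid (suc m) (suc n) t)
  (isTiling : IsTiling (suc m) (suc n) ts) (isTatami : IsTatami (suc m) (suc n) ts) where

  covered : ∀ {i j} → i < suc m → j < suc n → total (λ t → cells t i j) ts ≡ 1
  covered {i} {j} i< j< = begin
    total (λ t → cells t i j) ts         ≡⟨ total-cong _ _ ts (λ {t} _ → sym (χ-covers t i j)) ⟩
    total (χ ∘ covers? i j) ts           ≡⟨ length-filter (covers? i j) ts ⟨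
    length (filter (covers? i j) ts)     ≡⟨ count ⟩
    1                                    ∎
    where
    open ≡-Reasoning
    count : length (filter (covers? i j) ts) ≡ 1
    count = subst (λ i → length (filter (covers? i j) ts) ≡ 1) (toℕ-fromℕ< i<)
      (subst (λ j → length (filter (covers? (toℕ (fromℕ< i<)) j) ts) ≡ 1) (toℕ-fromℕ< j<)
        (isTiling (fromℕ< i<) (fromℕ< j<)))

  few-corners : ∀ {x y} → x < 2 + m → y < 2 + n → total (λ t → corners t x y) ts < 4
  few-corners {x} {y} x< y< = subst (_< 4)
    (trans (length-filter (cornerAt? x y) ts) (total-cong _ _ ts λ {t} _ → χ-corner t x y)) count
    where
    count : length (filter (cornerAt? x y) ts) < 4
    count = subst (λ x → length (filter (cornerAt? x y) ts) < 4) (toℕ-fromℕ< x<)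
      (subst (λ y → length (filter (cornerAt? (toℕ (fromℕ< x<)) y) ts) < 4) (toℕ-fromℕ< y<)
        (isTatami (fromℕ< x<) (fromℕ< y<)))

  -- Each of the four squares around an interior point is covered once; this is `cells-around`
  -- summed over the tiling.
  around : ∀ {x y} → x < m → y < n →
    4 ≡ total (λ t → corners t (suc x) (suc y)) ts + 2 * total (λ t → midline t (suc x) (suc y)) ts
  around {x} {y} x<m y<n = begin
    (1 + 1) + (1 + 1)
      ≡⟨ cong₂ _+_ (cong₂ _+_ (covered x< y<) (covered x< (s≤s y<n)))
                   (cong₂ _+_ (covered (s≤s x<m) y<) (covered (s≤s x<m) (s≤s y<n))) ⟨
    (total c₀₀ ts + total c₀₁ ts) + (total c₁₀ ts + total c₁₁ ts)
      ≡⟨ cong₂ _+_ (total-+ c₀₀ c₀₁ ts) (total-+ c₁₀ c₁₁ ts) ⟨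
    total (λ t → c₀₀ t + c₀₁ t) ts + total (λ t → c₁₀ t + c₁₁ t) ts
      ≡⟨ total-+ (λ t → c₀₀ t + c₀₁ t) (λ t → c₁₀ t + c₁₁ t) ts ⟨
    total (λ t → (c₀₀ t + c₀₁ t) + (c₁₀ t + c₁₁ t)) ts
      ≡⟨ total-cong _ _ ts (λ {t} _ → cells-around t x y) ⟩
    total (λ t → corners t (suc x) (suc y) + 2 * midline t (suc x) (suc y)) ts
      ≡⟨ total-+ (λ t → corners t (suc x) (suc y)) (λ t → 2 * midline t (suc x) (suc y)) ts ⟩
    total (λ t → corners t (suc x) (suc y)) ts + total (λ t → 2 * midline t (suc x) (suc y)) ts
      ≡⟨ cong (total (λ t → corners t (suc x) (suc y)) ts +_)
              (total-* 2 (λ t → midline t (suc x) (suc y)) ts) ⟩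
    total (λ t → corners t (suc x) (suc y)) ts + 2 * total (λ t → midline t (suc x) (suc y)) ts ∎
    where
    open ≡-Reasoning
    x< = <⇒≤ (s≤s x<m)
    y< = <⇒≤ (s≤s y<n)
    c₀₀ c₀₁ c₁₀ c₁₁ : Tile → ℕ
    c₀₀ t = cells t x y
    c₀₁ t = cells t x (suc y)
    c₁₀ t = cells t (suc x) y
    c₁₁ t = cells t (suc x) (suc y)

  -- Without a midline through the point, `around` would leave four tile corners there.
  on-midline : ∀ {x y} → x < m → y < n → 1 ≤ total (λ t → midline t (suc x) (suc y)) ts
  on-midline {x} {y} x<m y<n
    with total (λ t → midline t (suc x) (suc y)) ts | around x<m y<n
  ... | zero  | 4≡ = contradiction (sym (trans 4≡ (+-identityʳ _)))
    (<⇒≢ (few-corners (s≤s (<⇒≤ (s≤s x<m))) (s≤s (<⇒≤ (s≤s y<n)))))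
  ... | suc _ | _  = s≤s z≤n

  -- Border points weigh 0 and interior points lie on a midline.
  weight-on-midlines : ∀ k {x y} → x < 2 + m → y < 2 + n →
    weight k (suc m) (suc n) x y ≤
    weight k (suc m) (suc n) x y * total (λ t → midline t x y) ts
  weight-on-midlines k {zero} _ _ = z≤n
  weight-on-midlines k {suc x} {zero} _ _
    rewrite weight-left k (suc m) (suc n) (suc x) = z≤n
  weight-on-midlines k {suc x} {suc y} (s≤s (s≤s x≤m)) (s≤s (s≤s y≤n))
    with m≤n⇒m<n∨m≡n x≤m | m≤n⇒m<n∨m≡n y≤n
  ... | inj₂ refl | _ rewrite weight-bottom k (suc m) (suc n) (suc y) = z≤n
  ... | inj₁ _ | inj₂ refl rewrite weight-right k (suc m) (suc n) (suc x) = z≤n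
  ... | inj₁ x<m | inj₁ y<n = begin
    w      ≡⟨ *-identityʳ w ⟨
    w * 1  ≤⟨ *-monoʳ-≤ w (on-midline x<m y<n) ⟩
    w * total (λ t → midline t (suc x) (suc y)) ts ∎
    where
    open ≤-Reasoning
    w = weight k (suc m) (suc n) (suc x) (suc y)

  gridSum-tiles : ∀ g → total (λ t → gridSum (suc m) (suc n) (λ i j → g i j * cells t i j)) ts ≡
                        gridSum (suc m) (suc n) g
  gridSum-tiles g = trans (sym (gridSum-total (suc m) (suc n) g cells ts))
    (gridSum-cong (suc m) (suc n) λ {i} {j} i< j< →
      trans (cong (g i j *_) (covered i< j<)) (*-identityʳ (g i j)))

  area-count : suc m * suc n ≡ monomers ts + 2 * total dimer ts
  area-count = begin
    suc m * suc n
      ≡⟨ cong (suc m *_) (*-identityʳ (suc n)) ⟨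
    suc m * (suc n * 1)
      ≡⟨ gridSum-const (suc m) (suc n) 1 ⟨
    gridSum (suc m) (suc n) (λ _ _ → 1)
      ≡⟨ gridSum-tiles (λ _ _ → 1) ⟨
    total (λ t → gridSum (suc m) (suc n) (λ i j → 1 * cells t i j)) ts
      ≡⟨ total-cong _ _ ts (λ {t} t∈ → area (suc m) (suc n) t (inGrid t∈)) ⟩
    total (λ t → χ (isMonomer? t) + 2 * dimer t) ts
      ≡⟨ total-+ (χ ∘ isMonomer?) (λ t → 2 * dimer t) ts ⟩
    total (χ ∘ isMonomer?) ts + total (λ t → 2 * dimer t) ts
      ≡⟨ cong₂ _+_ (sym (length-filter isMonomer? ts)) (total-* 2 dimer ts) ⟩
    monomers ts + 2 * total dimer ts ∎
    where open ≡-Reasoning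

  -- Weak duality: the midlines carry at least the weight of all points, each dimer adds at most 2
  -- to the weight of its squares, and the tiles partition the squares.
  dimer-bound : ∀ k → k ≤ m → k ≤ n →
    totalWeight k (suc m) (suc n) ≤ 2 * total dimer ts + totalWeight k m n
  dimer-bound k k≤m k≤n = begin
    totalWeight k (suc m) (suc n)
      ≤⟨ gridSum-mono (2 + m) (2 + n) {W} {λ x y → W x y * total (λ t → midline t x y) ts}
           (weight-on-midlines k) ⟩
    gridSum (2 + m) (2 + n) (λ x y → W x y * total (λ t → midline t x y) ts)
      ≡⟨ gridSum-total (2 + m) (2 + n) W midline ts ⟩
    total (λ t → gridSum (2 + m) (2 + n) (λ x y → W x y * midline t x y)) ts
      ≤⟨ total-mono _ _ ts (λ {t} t∈ → midline-weight k m n t k≤m k≤n (inGrid t∈)) ⟩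
    total (λ t → 2 * dimer t + gridSum (suc m) (suc n) (λ i j → w i j * cells t i j)) ts
      ≡⟨ total-+ (λ t → 2 * dimer t) (λ t → gridSum (suc m) (suc n) (λ i j → w i j * cells t i j)) ts ⟩
    total (λ t → 2 * dimer t) ts + total (λ t → gridSum (suc m) (suc n) (λ i j → w i j * cells t i j)) ts
      ≡⟨ cong₂ _+_ (total-* 2 dimer ts) (gridSum-tiles w) ⟩
    2 * total dimer ts + totalWeight k m n ∎
    where
    open ≤-Reasoning
    W = weight k (suc m) (suc n)
    w = weight k m n

  -- `area-count` and `dimer-bound` put the same summand, twice the number of dimers plus the weight
  -- of the squares, on both sides of the gap inequality, where it cancels.
  monomer-bound : ∀ k {b} → k ≤ m → k ≤ n →
    suc m * suc n + totalWeight k m n ≤ totalWeight k (suc m) (suc n) + b → monomers ts ≤ b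
  monomer-bound k {b} k≤m k≤n gap = +-cancelˡ-≤ (2 * D + w) (monomers ts) b (begin
    2 * D + w + monomers ts          ≡⟨ arith D w (monomers ts) ⟩
    monomers ts + 2 * D + w          ≡⟨ cong (_+ w) area-count ⟨
    suc m * suc n + w                ≤⟨ gap ⟩
    totalWeight k (suc m) (suc n) + b  ≤⟨ +-monoˡ-≤ b (dimer-bound k k≤m k≤n) ⟩
    2 * D + w + b                    ∎)
    where
    open ≤-Reasoning
    D = total dimer ts
    w = totalWeight k m n
    arith : ∀ D w x → 2 * D + w + x ≡ x + 2 * D + w
    arith = solve-∀

  monomers-parity : monomers ts % 2 ≡ (suc m * suc n) % 2
  monomers-parity = begin
    monomers ts % 2                                ≡⟨ [m+kn]%n≡m%n (monomers ts) (total dimer ts) 2 ⟨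
    (monomers ts + total dimer ts * 2) % 2
      ≡⟨ cong (λ d → (monomers ts + d) % 2) (*-comm (total dimer ts) 2) ⟩
    (monomers ts + 2 * total dimer ts) % 2         ≡⟨ cong (_% 2) area-count ⟨
    (suc m * suc n) % 2                            ∎
    where open ≡-Reasoning

  monomers-≤ : monomers ts ≤ (2 + m) ⊔ (2 + n)
  monomers-≤ with ≤-total m n
  ... | inj₁ m≤n = ≤-trans (monomer-bound m ≤-refl m≤n (totalWeight-gap m n m≤n))
                           (m≤n⊔m (2 + m) (2 + n))
  -- The cutoff is the smaller of `m` and `n`; here it is `n`, and the gap inequality is transposed.
  ... | inj₂ n≤m = ≤-trans (monomer-bound n n≤m ≤-refl gap) (m≤m⊔n (2 + m) (2 + n))
    where
    gap : suc m * suc n + totalWeight n m n ≤ totalWeight n (suc m) (suc n) + (2 + m)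
    gap = subst₂ _≤_
      (cong₂ _+_ (*-comm (suc n) (suc m)) (totalWeight-comm n n m))
      (cong (_+ (2 + m)) (totalWeight-comm n (suc n) (suc m)))
      (totalWeight-gap n m n≤m)

-- From a positive count to a tiling.

filter-witness : {P : A → Set} (P? : Decidable P) (xs : List A) → 0 < length (filter P? xs) →
                 ∃[ x ] x ∈ xs × P x
filter-witness P? xs 0< with filter P? xs in eq
... | x ∷ _ = x , ∈-filter⁻ P? (subst (x ∈_) (sym eq) (here refl))

theorem1 : ∀ (r c m : ℕ) → 1 ≤ r → 1 ≤ c → 0 < T r c m →
    (m % 2 ≡ (r * c) % 2) × (m ≤ (r + 1) ⊔ (c + 1))
theorem1 (suc r) (suc c) m _ _ 0<T
  with filter-witness (tatamiTiling? (suc r) (suc c) m) (sublists (tiles (suc r) (suc c))) 0<T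
... | ts , ts∈ , isTiling , isTatami , refl =
  monomers-parity , subst (m ≤_) (cong₂ _⊔_ (+-comm 1 (suc r)) (+-comm 1 (suc c))) monomers-≤
  where
  open Tatami {r} {c} {ts}
    (λ t∈ → tiles-inGrid (suc r) (suc c) (sublist-⊆ (tiles (suc r) (suc c)) ts∈ t∈))
    isTiling isTatami
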